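{- Let $G=(V,E)$ be a connected, undirected, unweighted (multi-)graph with $|V|\ge 2$. Then $$\alpha(G)=\frac{1}{\min_{e\in E}\ell^{*}(e)},$$ where $\alpha(G)$ is the fractional arboricity of $G$ and $\ell^*(e)$ are the ideal relative loads of $G$.
   Context: Multigraphs may have parallel edges but no self-loops. For $S\subseteq V$, $E(S)$ denotes the set of edges with both endpoints in $S$, and $G[S]$ the induced subgraph. The fractional arboricity is $\alpha(G)=\max_{S\subseteq V,\,|S|\ge 2}\frac{|E(S)|}{|S|-1}$. For a partition $\mathcal P$ of $V$ with $|\mathcal P|\ge 2$, $G/\mathcal P$ is the multigraph obtained by contracting each class to a vertex; $E(G/\mathcal P)$ is the set of edges of $G$ whose endpoints lie in different classes. The partition value is $\mathrm{part\_val}(\mathcal P)=\frac{|E(G/\mathcal P)|}{|\mathcal P|-1}$, and $\Phi_G=\min_{\mathcal P}\mathrm{part\_val}(\mathcal P)$. The ideal relative loads $\ell^*(e)$, $e\in E$, are defined recursively: (1) let $\mathcal P^*$ be a partition of $V$ with $\mathrm{part\_val}(\mathcal P^*)=\Phi_G$; (2) for all $e\in E(G/\mathcal P^*)$ set $\ell^*(e)=1/\Phi_G$; (3) for each $S\in\mathcal P^*$ (with $|S|\ge 2$) recurse on the subgraph $G[S]$. (It is known that these values do not depend on the choices of $\mathcal P^*$.) -}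

module Defs where

open import Data.Fin using (Fin; zero; suc; fromℕ<)
import Data.Fin.Properties as Fin
open import Data.Fin.Subset using (Subset; _∈_; _⊆_; ⊤; ∣_∣; inside; outside)
open import Data.Fin.Subset.Properties using (_∈?_; ∣⊤∣≡n; p⊂q⇒∣p∣<∣q∣; x∈p⇒∣p-x∣<∣p∣)
open import Data.Integer using (+_)
open import Data.List using (List; []; _∷_; [_]; allFin; upTo; cartesianProductWith; concatMap; map)
open import Data.List.Membership.Propositional using (lose) renaming (_∈_ to _∈ₗ_)
open import Data.List.Membership.Propositional.Properties using (∈-cartesianProductWith⁺; ∈-allFin; ∈-upTo⁺; ∈-concatMap⁺; ∈-map⁺)
open import Data.List.Relation.Unary.Any using (here; there)
open import Data.Nat using (ℕ; zero; suc; _≤_; _<_; _∸_; z≤n; s≤s; NonZero; >-nonZero; _≤?_)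
open import Data.Nat.Induction using (<-wellFounded)
import Data.Nat.Properties as ℕ
open import Data.Product using (∃; ∃-syntax; Σ; _×_; _,_; proj₁; proj₂)
open import Data.Rational as ℚ using (ℚ; _/_; 1/_)
import Data.Rational.Properties as ℚ
open import Data.Sum using (_⊎_; inj₁; inj₂)
open import Data.Vec using (Vec; []; _∷_; tabulate; lookup; here; there)
open import Data.Vec.Properties using (lookup∘tabulate; []=⇒lookup; lookup⇒[]=; tabulate-cong)
open import Function using (_∘_; flip)
open import Induction.WellFounded using (Acc; acc)
open import Level using (0ℓ)
open import Relation.Binary using (Rel; Total; Transitive)
open import Relation.Binary.Construct.Closure.Equivalence using (EqClosure)
open import Relation.Binary.Construct.Closure.ReflexiveTransitive using (ε; _◅_)
open import Relation.Binary.Construct.Closure.Symmetric using (fwd; bwd)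
open import Relation.Binary.PropositionalEquality using (_≡_; _≢_; refl; sym; trans; cong; cong₂; subst)
open import Relation.Nullary using (¬_; Dec; yes; no; does; contradiction)
open import Relation.Nullary.Decidable using (_×-dec_; ¬?; dec-true)
open import Relation.Unary using (Pred; Decidable)

IsMaximum IsMinimum : Pred ℚ 0ℓ → Pred ℚ 0ℓ
IsMaximum X x = X x × (∀ {y} → X y → y ℚ.≤ x)
IsMinimum X x = X x × (∀ {y} → X y → x ℚ.≤ y)

subset : ∀ {n} {P : Pred (Fin n) 0ℓ} → Decidable P → Subset n
subset P? = tabulate (does ∘ P?)

∈-subset⁺ : ∀ {n} {P : Pred (Fin n) 0ℓ} (P? : Decidable P) → ∀ {x} → P x → x ∈ subset P?
∈-subset⁺ P? {x} p =
  lookup⇒[]= x _ (trans (lookup∘tabulate (does ∘ P?) x) (dec-true (P? x) p))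

∈-subset⁻ : ∀ {n} {P : Pred (Fin n) 0ℓ} (P? : Decidable P) → ∀ {x} → x ∈ subset P? → P x
∈-subset⁻ P? {x} x∈
  with P? x | trans (sym (lookup∘tabulate (does ∘ P?) x)) ([]=⇒lookup x∈)
... | yes p | _ = p

2≤⇒pred≢0 : ∀ {k} → 2 ≤ k → NonZero (k ∸ 1)
2≤⇒pred≢0 (s≤s (s≤s _)) = _

-- (a /pred k) _ is the rational a / (k - 1).
_/pred_ : ℕ → (k : ℕ) → .(2 ≤ k) → ℚ
(a /pred k) 2≤k = _/_ (+ a) (k ∸ 1) {{2≤⇒pred≢0 2≤k}}

-- Edges are undirected: which end of an edge is called src is arbitrary, and
-- every notion below is symmetric in src and tgt.
record Multigraph (n m : ℕ) : Set where
  field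
    src tgt  : Fin m → Fin n
    loopless : ∀ e → src e ≢ tgt e

-- A partition of S into at least two classes, given by a labelling of the
-- vertices under which every label is used in S.  Labels of vertices outside S play no role.
record Partition {n : ℕ} (S : Subset n) : Set where
  field
    size     : ℕ
    2≤size   : 2 ≤ size
    label    : Fin n → Fin size
    nonempty : ∀ i → ∃[ v ] v ∈ S × label v ≡ i

  inClass? : ∀ i → Decidable (λ v → v ∈ S × label v ≡ i)
  inClass? i v = (v ∈? S) ×-dec (label v Fin.≟ i)

  Class : Fin size → Subset n
  Class i = subset (inClass? i)

module _ {n m : ℕ} (G : Multigraph n m) where
  open Multigraph G

  Connected : Set
  Connected = ∀ u v → EqClosure (λ x y → ∃[ e ] src e ≡ x × tgt e ≡ y) u v

  inside? : (S : Subset n) → Decidable (λ e → src e ∈ S × tgt e ∈ S)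
  inside? S e = (src e ∈? S) ×-dec (tgt e ∈? S)

  -- E(S)
  edges : Subset n → Subset m
  edges S = subset (inside? S)

  density : (S : Subset n) → .(2 ≤ ∣ S ∣) → ℚ
  density S = ∣ edges S ∣ /pred ∣ S ∣

  IsFractionalArboricity : Pred ℚ 0ℓ
  IsFractionalArboricity = IsMaximum (λ x → ∃[ S ] Σ (2 ≤ ∣ S ∣) λ 2≤ → x ≡ density S 2≤)

  crossing? : ∀ {k} (S : Subset n) (label : Fin n → Fin k) →
    Decidable (λ e → (src e ∈ S × tgt e ∈ S) × label (src e) ≢ label (tgt e))
  crossing? S label e = inside? S e ×-dec ¬? (label (src e) Fin.≟ label (tgt e))

  -- E(G[S]/P), where P is the partition of S described by the labelling.
  crossing : ∀ {k} → Subset n → (Fin n → Fin k) → Subset m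
  crossing S label = subset (crossing? S label)

  module _ {S : Subset n} (P : Partition S) where
    open Partition P

    cut : Subset m
    cut = crossing S label

    partVal : ℚ
    partVal = (∣ cut ∣ /pred size) 2≤size

    partVal≢0 : ∀ {e} → e ∈ cut → ℚ.NonZero partVal
    partVal≢0 e∈ = ℚ.pos⇒nonZero partVal {{partVal>0}}
      where
      0<∣cut∣ : 0 < ∣ cut ∣
      0<∣cut∣ = ℕ.≤-<-trans z≤n (x∈p⇒∣p-x∣<∣p∣ e∈)

      partVal>0 : ℚ.Positive partVal
      partVal>0 = ℚ.normalize-pos ∣ cut ∣ (size ∸ 1) {{2≤⇒pred≢0 2≤size}} {{>-nonZero 0<∣cut∣}}

  -- partVal P = Φ_{G[S]}
  Optimal : ∀ {S} → Partition S → Set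
  Optimal {S} P = (Q : Partition S) → partVal P ℚ.≤ partVal Q

  -- ℓ restricted to E(S) is a possible outcome of the recursion on G[S],
  -- whichever optimal partitions are chosen on the way.
  data IsIdealOn (ℓ : Fin m → ℚ) (S : Subset n) : Set where
    split : (P : Partition S) → Optimal P →
      (∀ {e} (e∈ : e ∈ cut P) → ℓ e ≡ 1/_ (partVal P) {{partVal≢0 P e∈}}) →
      (∀ i → 2 ≤ ∣ Partition.Class P i ∣ → IsIdealOn ℓ (Partition.Class P i)) →
      IsIdealOn ℓ S

  IsIdealLoads : (Fin m → ℚ) → Set
  IsIdealLoads ℓ = IsIdealOn ℓ ⊤

  IsMinLoad : (Fin m → ℚ) → Pred ℚ 0ℓ
  IsMinLoad ℓ = IsMinimum (λ x → ∃[ e ] x ≡ ℓ e)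

-- The relations above are inhabited: fractional arboricity, ideal loads and
-- the minimum load all exist.

module _ {A : Set} {P : Pred A 0ℓ} (P? : Decidable P) (f : ∀ a → .(P a) → ℚ)
         (_≼_ : Rel ℚ 0ℓ) (≼-total : Total _≼_) (≼-trans : Transitive _≼_) where

  ≼-refl : ∀ {x} → x ≼ x
  ≼-refl {x} with ≼-total x x
  ... | inj₁ r = r
  ... | inj₂ r = r

  best : (xs : List A) → (∀ {a} → a ∈ₗ xs → ¬ P a) ⊎
    (∃[ a ] Σ (P a) λ p → ∀ {b} → b ∈ₗ xs → (q : P b) → f a p ≼ f b q)
  best [] = inj₁ λ ()
  best (x ∷ xs) with P? x | best xs
  ... | no ¬p | inj₁ none = inj₁ λ { (here refl) → ¬p ; (there a∈) → none a∈ }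
  ... | no ¬p | inj₂ (a , p , least) =
    inj₂ (a , p , λ { (here refl) q → contradiction q ¬p ; (there b∈) q → least b∈ q })
  ... | yes p | inj₁ none =
    inj₂ (x , p , λ { (here refl) _ → ≼-refl ; (there b∈) q → contradiction q (none b∈) })
  ... | yes p | inj₂ (a , q , least) with ≼-total (f x p) (f a q)
  ...   | inj₁ x≼a =
    inj₂ (x , p , λ { (here refl) _ → ≼-refl ; (there b∈) r → ≼-trans x≼a (least b∈ r) })
  ...   | inj₂ a≼x =
    inj₂ (a , q , λ { (here refl) _ → a≼x ; (there b∈) r → least b∈ r })

  best! : (xs : List A) → (∀ a → P a → a ∈ₗ xs) → ∃ P →
    ∃[ a ] Σ (P a) λ p → ∀ b (q : P b) → f a p ≼ f b q
  best! xs complete (a₀ , p₀) with best xs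
  ... | inj₁ none = contradiction p₀ (none (complete a₀ p₀))
  ... | inj₂ (a , p , least) = a , p , λ b q → least (complete b q) q

vectors : {A : Set} → List A → ∀ n → List (Vec A n)
vectors xs zero    = [ [] ]
vectors xs (suc n) = cartesianProductWith _∷_ xs (vectors xs n)

∈-vectors : ∀ {A : Set} {xs : List A} → (∀ a → a ∈ₗ xs) → ∀ {n} (v : Vec A n) → v ∈ₗ vectors xs n
∈-vectors all []      = here refl
∈-vectors all (a ∷ v) = ∈-cartesianProductWith⁺ _∷_ (all a) (∈-vectors all v)

member : ∀ {n} (S : Subset n) → 1 ≤ ∣ S ∣ → ∃[ u ] u ∈ S
member (inside  ∷ S) _ = zero , here
member (outside ∷ S) p with u , u∈ ← member S p = suc u , there u∈

twoMembers : ∀ {n} (S : Subset n) → 2 ≤ ∣ S ∣ → ∃[ u ] ∃[ v ] u ∈ S × v ∈ S × u ≢ v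
twoMembers (inside ∷ S) (s≤s p) with v , v∈ ← member S p =
  zero , suc v , here , there v∈ , λ ()
twoMembers (outside ∷ S) p with u , v , u∈ , v∈ , u≢v ← twoMembers S p =
  suc u , suc v , there u∈ , there v∈ , u≢v ∘ Fin.suc-injective

2≤∣⊤∣ : ∀ {n} → 2 ≤ n → 2 ≤ ∣ ⊤ {n} ∣
2≤∣⊤∣ {n} = subst (2 ≤_) (sym (∣⊤∣≡n n))

module _ {n : ℕ} {S : Subset n} where

  bipartition : 2 ≤ ∣ S ∣ → Partition S
  bipartition 2≤ with u , v , u∈ , v∈ , u≢v ← twoMembers S 2≤ = record
    { size = 2 ; 2≤size = s≤s (s≤s z≤n) ; label = label ; nonempty = nonempty }
    where
    label : Fin n → Fin 2
    label w with w Fin.≟ u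
    ... | yes _ = zero
    ... | no  _ = suc zero

    label-u : label u ≡ zero
    label-u with u Fin.≟ u
    ... | yes _ = refl
    ... | no ¬p = contradiction refl ¬p

    label-v : label v ≡ suc zero
    label-v with v Fin.≟ u
    ... | yes p = contradiction (sym p) u≢v
    ... | no  _ = refl

    nonempty : ∀ i → ∃[ w ] w ∈ S × label w ≡ i
    nonempty zero       = u , u∈ , label-u
    nonempty (suc zero) = v , v∈ , label-v

  size≤n : (P : Partition S) → Partition.size P ≤ n
  size≤n P = Fin.injective⇒≤ {f = proj₁ ∘ nonempty} λ {i} {j} eq →
    trans (sym (proj₂ (proj₂ (nonempty i)))) (trans (cong label eq) (proj₂ (proj₂ (nonempty j))))
    where open Partition P

  Class⊆ : (P : Partition S) → ∀ i → Partition.Class P i ⊆ S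
  Class⊆ P i = proj₁ ∘ ∈-subset⁻ (Partition.inClass? P i)

  otherLabel : ∀ {k} → 2 ≤ k → (i : Fin k) → ∃[ j ] j ≢ i
  otherLabel (s≤s (s≤s _)) zero    = suc zero , λ ()
  otherLabel (s≤s (s≤s _)) (suc _) = zero , λ ()

  ∣Class∣<∣S∣ : (P : Partition S) → ∀ i → ∣ Partition.Class P i ∣ < ∣ S ∣
  ∣Class∣<∣S∣ P i
    with j , j≢i ← otherLabel (Partition.2≤size P) i
    with v , v∈ , refl ← Partition.nonempty P j =
    p⊂q⇒∣p∣<∣q∣ (Class⊆ P i , v , v∈ , j≢i ∘ proj₂ ∘ ∈-subset⁻ (Partition.inClass? P i))

module _ {n m : ℕ} (G : Multigraph n m) where
  open Multigraph G

  Labelling : Set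
  Labelling = ∃[ k ] Vec (Fin k) n

  IsPartition : Subset n → Pred Labelling 0ℓ
  IsPartition S (k , c) = 2 ≤ k × (∀ i → ∃[ v ] v ∈ S × lookup c v ≡ i)

  isPartition? : ∀ S → Decidable (IsPartition S)
  isPartition? S (k , c) =
    (2 ≤? k) ×-dec Fin.all? λ i → Fin.any? λ v → (v ∈? S) ×-dec (lookup c v Fin.≟ i)

  toPartition : ∀ {S} c → IsPartition S c → Partition S
  toPartition (k , c) (2≤k , ne) =
    record { size = k ; 2≤size = 2≤k ; label = lookup c ; nonempty = ne }

  fromPartition : ∀ {S} → Partition S → ∃ (IsPartition S)
  fromPartition P = (size , tabulate label) , 2≤size , λ i →
    let v , v∈ , eq = nonempty i in v , v∈ , trans (lookup∘tabulate label v) eq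
    where open Partition P

  labellingVal : ∀ S c → .(IsPartition S c) → ℚ
  labellingVal S (k , c) p = (∣ crossing G S (lookup c) ∣ /pred k) (proj₁ p)

  crossing-cong : ∀ S {k} {c d : Fin n → Fin k} → (∀ v → c v ≡ d v) → crossing G S c ≡ crossing G S d
  crossing-cong S {k} {c} {d} c≗d = tabulate-cong λ e →
    cong₂ (λ x y → does (inside? G S e ×-dec ¬? (x Fin.≟ y))) (c≗d (src e)) (c≗d (tgt e))

  labellings : List Labelling
  labellings = concatMap (λ k → map (k ,_) (vectors (allFin k) n)) (upTo (suc n))

  ∈-labellings : ∀ {S} c → IsPartition S c → c ∈ₗ labellings
  ∈-labellings (k , c) p = ∈-concatMap⁺ (λ k → map (k ,_) (vectors (allFin k) n))
    (lose (∈-upTo⁺ (s≤s (size≤n (toPartition (k , c) p)))) (∈-map⁺ (k ,_) (∈-vectors ∈-allFin c)))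

  optimalPartition : ∀ {S} → 2 ≤ ∣ S ∣ → ∃[ P ] Optimal G {S} P
  optimalPartition {S} 2≤ = toPartition c p , λ Q →
    let open Partition Q; d , q = fromPartition Q in
    subst (λ C → partVal G (toPartition c p) ℚ.≤ (∣ C ∣ /pred size) 2≤size)
      (crossing-cong S (lookup∘tabulate label)) (least d q)
    where
    optimum : ∃[ c ] Σ (IsPartition S c) λ p → ∀ d q → labellingVal S c p ℚ.≤ labellingVal S d q
    optimum = best! (isPartition? S) (labellingVal S) ℚ._≤_ ℚ.≤-total ℚ.≤-trans
                labellings ∈-labellings (fromPartition (bipartition 2≤))

    c     = proj₁ optimum
    p     = proj₁ (proj₂ optimum)
    least = proj₂ (proj₂ optimum)

  IsIdealOn-cong : ∀ {ℓ ℓ′ S} → (∀ {e} → e ∈ edges G S → ℓ e ≡ ℓ′ e) →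
    IsIdealOn G ℓ S → IsIdealOn G ℓ′ S
  IsIdealOn-cong {S = S} ℓ≗ℓ′ (split P opt loads rec) = split P opt
    (λ e∈ → trans (sym (ℓ≗ℓ′ (∈-subset⁺ (inside? G S) (proj₁ (∈-subset⁻ (crossing? G S label) e∈))))) (loads e∈))
    (λ i 2≤ → IsIdealOn-cong {S = Class i}
      (λ e∈ → let u∈ , v∈ = ∈-subset⁻ (inside? G (Class i)) e∈ in
              ℓ≗ℓ′ (∈-subset⁺ (inside? G S) (Class⊆ P i u∈ , Class⊆ P i v∈)))
      (rec i 2≤))
    where open Partition P

  module Combine {S : Subset n} (P : Partition S) (ℓs : Fin (Partition.size P) → Fin m → ℚ) where
    open Partition P

    loadAt : ∀ e → Dec (e ∈ cut G P) → ℚ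
    loadAt e (yes e∈) = 1/_ (partVal G P) {{partVal≢0 G P e∈}}
    loadAt e (no  _)  = ℓs (label (src e)) e

    combined : Fin m → ℚ
    combined e = loadAt e (e ∈? cut G P)

    loadAt-cut : ∀ {e} (d : Dec (e ∈ cut G P)) (e∈ : e ∈ cut G P) →
      loadAt e d ≡ 1/_ (partVal G P) {{partVal≢0 G P e∈}}
    loadAt-cut (yes _) _  = refl
    loadAt-cut (no e∉) e∈ = contradiction e∈ e∉

    loadAt-inner : ∀ i {e} (d : Dec (e ∈ cut G P)) → label (src e) ≡ i → label (tgt e) ≡ i →
      ℓs i e ≡ loadAt e d
    loadAt-inner i (yes e∈) u≡i v≡i =
      contradiction (trans u≡i (sym v≡i)) (proj₂ (∈-subset⁻ (crossing? G S label) e∈))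
    loadAt-inner i {e} (no _) u≡i _ = cong (λ j → ℓs j e) (sym u≡i)

    combined-ideal : Optimal G P →
      (∀ i → 2 ≤ ∣ Class i ∣ → IsIdealOn G (ℓs i) (Class i)) → IsIdealOn G combined S
    combined-ideal opt ideal = split P opt (λ {e} → loadAt-cut (e ∈? cut G P)) λ i 2≤ →
      IsIdealOn-cong
        (λ {e} e∈ → let u∈ , v∈ = ∈-subset⁻ (inside? G (Class i)) e∈ in
          loadAt-inner i (e ∈? cut G P)
            (proj₂ (∈-subset⁻ (inClass? i) u∈)) (proj₂ (∈-subset⁻ (inClass? i) v∈)))
        (ideal i 2≤)

  idealOn-exists : ∀ S → Acc _<_ ∣ S ∣ → ∃[ ℓ ] (2 ≤ ∣ S ∣ → IsIdealOn G ℓ S)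
  idealOn-exists S (acc rs) = step (2 ≤? ∣ S ∣)
    where
    step : Dec (2 ≤ ∣ S ∣) → ∃[ ℓ ] (2 ≤ ∣ S ∣ → IsIdealOn G ℓ S)
    step (no 2≰) = (λ _ → ℚ.0ℚ) , λ 2≤ → contradiction 2≤ 2≰
    step (yes 2≤) = combined , λ _ → combined-ideal (proj₂ best-P) (λ i → proj₂ (sub i))
      where
      best-P : ∃[ P ] Optimal G {S} P
      best-P = optimalPartition 2≤

      P : Partition S
      P = proj₁ best-P

      sub : ∀ i → ∃[ ℓ ] (2 ≤ ∣ Partition.Class P i ∣ → IsIdealOn G ℓ (Partition.Class P i))
      sub i = idealOn-exists (Partition.Class P i) (rs (∣Class∣<∣S∣ P i))

      open Combine P (proj₁ ∘ sub)

  idealLoads-exist : 2 ≤ n → ∃[ ℓ ] IsIdealLoads G ℓ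
  idealLoads-exist 2≤n with ℓ , ideal ← idealOn-exists ⊤ (<-wellFounded _) =
    ℓ , ideal (2≤∣⊤∣ 2≤n)

  fractionalArboricity-exists : 2 ≤ n → ∃[ α ] IsFractionalArboricity G α
  fractionalArboricity-exists 2≤n =
    density G S 2≤ , (S , 2≤ , refl) , λ { (T , 2≤T , refl) → greatest T 2≤T }
    where
    densest : ∃[ S ] Σ (2 ≤ ∣ S ∣) λ 2≤ → ∀ T (2≤T : 2 ≤ ∣ T ∣) → density G T 2≤T ℚ.≤ density G S 2≤
    densest = best! (λ S → 2 ≤? ∣ S ∣) (density G) (flip ℚ._≤_) (flip ℚ.≤-total) (flip ℚ.≤-trans)
                (vectors (inside ∷ outside ∷ []) n)
                (λ S _ → ∈-vectors (λ { inside → here refl ; outside → there (here refl) }) S)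
                (⊤ , 2≤∣⊤∣ 2≤n)

    S        = proj₁ densest
    2≤       = proj₁ (proj₂ densest)
    greatest = proj₂ (proj₂ densest)

  edge-exists : 2 ≤ n → Connected G → Fin m
  edge-exists (s≤s (s≤s _)) conn with conn zero (suc zero)
  ... | fwd (e , _) ◅ _ = e
  ... | bwd (e , _) ◅ _ = e

  minLoad-exists : 2 ≤ n → Connected G → ∀ ℓ → ∃[ x ] IsMinLoad G ℓ x
  minLoad-exists 2≤n conn ℓ
    with e , _ , least ← best! {P = λ e → e ≡ e} (λ _ → yes refl) (λ e _ → ℓ e)
                           ℚ._≤_ ℚ.≤-total ℚ.≤-trans (allFin m) (λ e _ → ∈-allFin e)
                           (edge-exists 2≤n conn , refl) =
    ℓ e , (e , refl) , λ { (d , refl) → least d refl }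

{-# OPTIONS --safe #-}
module Submission where

-- Every ideal load is 1/Φ for an optimal partition of some vertex set T; comparing that partition
-- with the one into singletons gives Φ ≤ |E(T)|/(|T| - 1) ≤ α, hence 1/ℓ*(e) ≤ α for all e.
--
-- Conversely let S be a densest set, and let P, of value Φ, be the first partition of
-- the recursion that separates vertices of S.  Say S meets t classes and has c edges between them.
-- Merging these t classes cannot decrease the value of P, so c ≤ Φ (t - 1); and the parts of S inside
-- the classes are at most as dense as S, so c ≥ α (t - 1).  As t ≥ 2, α ≤ Φ = 1/ℓ*(e) for e cut by P.

open import Defs
open import Data.Bool using (if_then_else_)
open import Data.Fin using (Fin; zero; suc)
import Data.Fin.Properties as Fin
open import Data.Fin.Subset using (Subset; _∈_; _∉_; _⊆_; ⊤; ∁; ∣_∣; _-_; inside; outside)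
open import Data.Fin.Subset.Properties
  using (_∈?_; ∈⊤; ∣∁p∣≡n∸∣p∣; p⊆q⇒∣p∣≤∣q∣; x∈p⇒∣p-x∣<∣p∣; x∈p∧x≢y⇒x∈p-y; x∈∁p⇒x∉p)
open import Data.Integer as ℤ using (+[1+_])
import Data.Integer.Properties as ℤ
open import Data.Nat using (ℕ; zero; suc; _+_; _*_; _∸_; _≤_; _<_; z≤n; s≤s; >-nonZero; _≤?_)
import Data.Nat.Properties as ℕ
open import Data.Nat.Tactic.RingSolver using (solve-∀)
open import Data.Product using (∃-syntax; Σ; _×_; _,_; proj₁; proj₂)
open import Data.Rational as ℚ using (ℚ; mkℚ; 1/_; NonZero)
import Data.Rational.Properties as ℚ
import Data.Rational.Unnormalised as ℚᵘ
import Data.Rational.Unnormalised.Properties as ℚᵘ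
open import Data.Sum using (_⊎_; inj₁; inj₂; [_,_]′)
open import Data.Vec using ([]; _∷_; here; there)
open import Function using (_∘_; id)
open import Relation.Binary.PropositionalEquality
  using (_≡_; _≢_; refl; sym; trans; cong; cong₂; subst; subst₂; module ≡-Reasoning)
open import Relation.Nullary using (¬_; Dec; yes; no; does; contradiction)
open import Relation.Nullary.Decidable using (_×-dec_; ¬?; decidable-stable)

open import Algebra.Properties.Semiring.Sum ℕ.+-*-semiring
  using (sum; sum-syntax; sum-cong-≗; sum-remove; sum-replicate-zero; ∑-distrib-+; ∑-comm;
         *-distribˡ-sum; *-distribʳ-sum)

-- Fractions with denominator `k - 1`.

-- Unnormalised rationals keep numerator and denominator as given, whereas `_/_` reduces to lowest
-- terms; there, comparing two such fractions is cross multiplication.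
/pred-≃ : ∀ a {k} (2≤k : 2 ≤ suc (suc k)) →
  ℚ.toℚᵘ ((a /pred suc (suc k)) 2≤k) ℚᵘ.≃ ℚᵘ.mkℚᵘ (ℤ.+ a) k
/pred-≃ a {k} _ = ℚ.toℚᵘ-fromℚᵘ (ℚᵘ.mkℚᵘ (ℤ.+ a) k)

/pred-≤⁺ : ∀ a c {k l} (2≤k : 2 ≤ k) (2≤l : 2 ≤ l) →
  a * (l ∸ 1) ≤ c * (k ∸ 1) → (a /pred k) 2≤k ℚ.≤ (c /pred l) 2≤l
/pred-≤⁺ a c 2≤k@(s≤s (s≤s {n = k} _)) 2≤l@(s≤s (s≤s {n = l} _)) le =
  ℚ.toℚᵘ-cancel-≤
    (ℚᵘ.≤-respˡ-≃ (ℚᵘ.≃-sym (/pred-≃ a 2≤k)) (ℚᵘ.≤-respʳ-≃ (ℚᵘ.≃-sym (/pred-≃ c 2≤l))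
      (ℚᵘ.*≤* (subst₂ ℤ._≤_ (ℤ.pos-* a (suc l)) (ℤ.pos-* c (suc k)) (ℤ.+≤+ le)))))

/pred-≤⁻ : ∀ a c {k l} (2≤k : 2 ≤ k) (2≤l : 2 ≤ l) →
  (a /pred k) 2≤k ℚ.≤ (c /pred l) 2≤l → a * (l ∸ 1) ≤ c * (k ∸ 1)
/pred-≤⁻ a c 2≤k@(s≤s (s≤s {n = k} _)) 2≤l@(s≤s (s≤s {n = l} _)) le =
  ℤ.drop‿+≤+ (subst₂ ℤ._≤_ (sym (ℤ.pos-* a (suc l))) (sym (ℤ.pos-* c (suc k)))
    (ℚᵘ.drop-*≤* (ℚᵘ.≤-respˡ-≃ (/pred-≃ a 2≤k) (ℚᵘ.≤-respʳ-≃ (/pred-≃ c 2≤l) (ℚ.toℚᵘ-mono-≤ le)))))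

/pred-positive : ∀ a {k} (2≤k : 2 ≤ k) → 0 < a → ℚ.Positive ((a /pred k) 2≤k)
/pred-positive a {k} 2≤k 0<a =
  ℚ.normalize-pos a (k ∸ 1) {{2≤⇒pred≢0 2≤k}} {{>-nonZero 0<a}}

-- Reciprocals of positive fractions exchange numerator and denominator, so both inequalities
-- cross-multiply to the same one.
1/-cancel-≤-pos : ∀ p q {{p>0 : ℚ.Positive p}} {{q>0 : ℚ.Positive q}} →
  (1/ p) {{ℚ.pos⇒nonZero p}} ℚ.≤ (1/ q) {{ℚ.pos⇒nonZero q}} → q ℚ.≤ p
1/-cancel-≤-pos (mkℚ +[1+ n ] d _) (mkℚ +[1+ m ] e _) (ℚ.*≤* le) =
  ℚ.*≤* (subst₂ ℤ._≤_ (ℤ.*-comm +[1+ d ] +[1+ m ]) (ℤ.*-comm +[1+ e ] +[1+ n ]) le)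

-- Counting by sums of indicators.

𝟙 : ∀ {A : Set} → Dec A → ℕ
𝟙 a? = if does a? then 1 else 0

𝟙-mono : ∀ {A B : Set} (a? : Dec A) (b? : Dec B) → (A → B) → 𝟙 a? ≤ 𝟙 b?
𝟙-mono (no _)  _       _ = z≤n
𝟙-mono (yes _) (yes _) _ = ℕ.≤-refl
𝟙-mono (yes a) (no ¬b) f = contradiction (f a) ¬b

𝟙≤1 : ∀ {A : Set} (a? : Dec A) → 𝟙 a? ≤ 1
𝟙≤1 (no _)  = z≤n
𝟙≤1 (yes _) = ℕ.≤-refl

𝟙-no : ∀ {A : Set} (a? : Dec A) → ¬ A → 𝟙 a? ≡ 0
𝟙-no (no _)  _  = refl
𝟙-no (yes a) ¬a = contradiction a ¬a

sum-mono : ∀ {k} {f g : Fin k → ℕ} → (∀ i → f i ≤ g i) → sum f ≤ sum g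
sum-mono {zero}  _   = z≤n
sum-mono {suc k} f≤g = ℕ.+-mono-≤ (f≤g zero) (sum-mono (f≤g ∘ suc))

sum-single : ∀ {k} (f : Fin k → ℕ) j → (∀ i → i ≢ j → f i ≡ 0) → sum f ≡ f j
sum-single {suc k} f j f≡0 = trans (sum-remove f)
  (trans (cong (f j +_) (trans (sum-cong-≗ λ i → f≡0 _ (Fin.punchInᵢ≢i j i)) (sum-replicate-zero k)))
         (ℕ.+-identityʳ (f j)))

-- With cardinalities as sums, inclusions can be checked pointwise and double sums exchanged.
∣S∣≡∑ : ∀ {n} (S : Subset n) → ∣ S ∣ ≡ ∑[ x < n ] 𝟙 (x ∈? S)
∣S∣≡∑ {zero}  [] = refl
∣S∣≡∑ {suc n} (inside  ∷ S) = cong suc (∣S∣≡∑ S)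
∣S∣≡∑ {suc n} (outside ∷ S) = ∣S∣≡∑ S

∣S∣+∣T∣≡∑ : ∀ {n} (S T : Subset n) → ∣ S ∣ + ∣ T ∣ ≡ ∑[ x < n ] (𝟙 (x ∈? S) + 𝟙 (x ∈? T))
∣S∣+∣T∣≡∑ S T = trans (cong₂ _+_ (∣S∣≡∑ S) (∣S∣≡∑ T)) (sym (∑-distrib-+ (λ x → 𝟙 (x ∈? S)) _))

disjoint⇒∣S∣+∣T∣≤∣U∣ : ∀ {n} {S T U : Subset n} → S ⊆ U → T ⊆ U → (∀ {x} → x ∈ S → x ∉ T) →
  ∣ S ∣ + ∣ T ∣ ≤ ∣ U ∣
disjoint⇒∣S∣+∣T∣≤∣U∣ {S = S} {T} {U} S⊆U T⊆U disjoint =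
  subst₂ _≤_ (sym (∣S∣+∣T∣≡∑ S T)) (sym (∣S∣≡∑ U))
    (sum-mono λ x → pointwise x (x ∈? S) (x ∈? T) (x ∈? U))
  where
  pointwise : ∀ x (s? : Dec (x ∈ S)) (t? : Dec (x ∈ T)) (u? : Dec (x ∈ U)) → 𝟙 s? + 𝟙 t? ≤ 𝟙 u?
  pointwise x (yes s) (yes t) u? = contradiction t (disjoint s)
  pointwise x (yes s) (no _)  u? = 𝟙-mono (yes s) u? S⊆U
  pointwise x (no _)  t?      u? = 𝟙-mono t? u? T⊆U

cover⇒∣U∣≤∣S∣+∣T∣ : ∀ {n} {S T U : Subset n} → (∀ {x} → x ∈ U → x ∈ S ⊎ x ∈ T) →
  ∣ U ∣ ≤ ∣ S ∣ + ∣ T ∣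
cover⇒∣U∣≤∣S∣+∣T∣ {S = S} {T} {U} cover =
  subst₂ _≤_ (sym (∣S∣≡∑ U)) (sym (∣S∣+∣T∣≡∑ S T))
    (sum-mono λ x → pointwise x (x ∈? S) (x ∈? T) (x ∈? U))
  where
  pointwise : ∀ x (s? : Dec (x ∈ S)) (t? : Dec (x ∈ T)) (u? : Dec (x ∈ U)) → 𝟙 u? ≤ 𝟙 s? + 𝟙 t?
  pointwise x s?      t?      (no _)  = z≤n
  pointwise x (yes _) t?      (yes _) = s≤s z≤n
  pointwise x (no s∉) t?      (yes u) =
    𝟙-mono (yes u) t? λ u → [ (λ s → contradiction s s∉) , id ]′ (cover u)

inFibre? : ∀ {n k} (g : Fin n → Fin k) (S : Subset n) i v → Dec (v ∈ S × g v ≡ i)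
inFibre? g S i v = (v ∈? S) ×-dec (g v Fin.≟ i)

fibre : ∀ {n k} → (Fin n → Fin k) → Subset n → Fin k → Subset n
fibre g S i = subset (inFibre? g S i)

∈-fibre⁺ : ∀ {n k} (g : Fin n → Fin k) {S} {x} → x ∈ S → x ∈ fibre g S (g x)
∈-fibre⁺ g {S} x∈ = ∈-subset⁺ (inFibre? g S _) (x∈ , refl)

∈-fibre⁻ : ∀ {n k} (g : Fin n → Fin k) {S i} {x} → x ∈ fibre g S i → x ∈ S × g x ≡ i
∈-fibre⁻ g {S} {i} = ∈-subset⁻ (inFibre? g S i)

-- Double counting: once the sums are exchanged, `x` contributes only at `i = g x`.
∑∣fibre∣≡∣S∣ : ∀ {n k} (g : Fin n → Fin k) (S : Subset n) → ∑[ i < k ] ∣ fibre g S i ∣ ≡ ∣ S ∣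
∑∣fibre∣≡∣S∣ {n} {k} g S = begin
  ∑[ i < k ] ∣ fibre g S i ∣                     ≡⟨ sum-cong-≗ (λ i → ∣S∣≡∑ (fibre g S i)) ⟩
  ∑[ i < k ] ∑[ x < n ] 𝟙 (x ∈? fibre g S i)     ≡⟨ ∑-comm (λ i x → 𝟙 (x ∈? fibre g S i)) ⟩
  ∑[ x < n ] ∑[ i < k ] 𝟙 (x ∈? fibre g S i)     ≡⟨ sum-cong-≗ only-own ⟩
  ∑[ x < n ] 𝟙 (x ∈? S)                          ≡⟨ ∣S∣≡∑ S ⟨
  ∣ S ∣                                          ∎
  where
  open ≡-Reasoning
  only-own : ∀ x → ∑[ i < k ] 𝟙 (x ∈? fibre g S i) ≡ 𝟙 (x ∈? S)
  only-own x = trans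
    (sum-single _ (g x) λ i i≢ → 𝟙-no (x ∈? fibre g S i) λ x∈ → i≢ (sym (proj₂ (∈-fibre⁻ g x∈))))
    (ℕ.≤-antisym (𝟙-mono (x ∈? fibre g S (g x)) (x ∈? S) (proj₁ ∘ ∈-fibre⁻ g))
                 (𝟙-mono (x ∈? S) (x ∈? fibre g S (g x)) (∈-fibre⁺ g)))

1≤∣S∣ : ∀ {n} {S : Subset n} {x} → x ∈ S → 1 ≤ ∣ S ∣
1≤∣S∣ x∈ = ℕ.≤-<-trans z≤n (x∈p⇒∣p-x∣<∣p∣ x∈)

2≤∣S∣ : ∀ {n} {S : Subset n} {x y} → x ∈ S → y ∈ S → x ≢ y → 2 ≤ ∣ S ∣
2≤∣S∣ x∈ y∈ x≢y =
  ℕ.≤-trans (s≤s (1≤∣S∣ (x∈p∧x≢y⇒x∈p-y y∈ (x≢y ∘ sym)))) (x∈p⇒∣p-x∣<∣p∣ x∈)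

-- Partitions built from labellings.

-- Numbers `J` consecutively, because every label of a `Partition` must be in use; labels outside
-- `J` are sent to some element to keep the map total.
retraction : ∀ {k} (J : Subset k) → 1 ≤ ∣ J ∣ → Σ (Fin k → Fin ∣ J ∣) λ r → ∀ i → ∃[ j ] j ∈ J × r j ≡ i
retraction (outside ∷ J) 1≤ with r , onto ← retraction J 1≤ =
  (λ { zero → r (proj₁ (member J 1≤)) ; (suc j) → r j }) ,
  λ i → let j , j∈ , eq = onto i in suc j , there j∈ , eq
retraction (inside ∷ J) _ with ∣ J ∣ | retraction J
-- An empty tail admits no recursive call, so everything is sent to the only element.
... | zero  | _ = (λ _ → zero) , λ { zero → zero , here , refl }
... | suc _ | rec with r , onto ← rec (s≤s z≤n) =
  (λ { zero → zero ; (suc j) → suc (r j) }) ,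
  λ { zero → zero , here , refl
    ; (suc i) → let j , j∈ , eq = onto i in suc j , there j∈ , cong suc eq }

-- Makes a `Partition` with one class per element of `J`. Vertices with equal `f`-labels stay
-- together, which bounds its cut from above.
relabel : ∀ {n k} {S : Subset n} (J : Subset k) → 2 ≤ ∣ J ∣ → (f : Fin n → Fin k) →
  (∀ {j} → j ∈ J → ∃[ v ] v ∈ S × f v ≡ j) →
  Σ (Partition S) λ Q → Partition.size Q ≡ ∣ J ∣ ×
    (∀ {u v} → f u ≡ f v → Partition.label Q u ≡ Partition.label Q v)
relabel J 2≤ f hit with r , onto ← retraction J (ℕ.≤-trans (s≤s z≤n) 2≤) =
  record
    { size = ∣ J ∣ ; 2≤size = 2≤ ; label = r ∘ f
    ; nonempty = λ i → let j , j∈ , rj≡i = onto i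
                           v , v∈ , fv≡j = hit j∈
                       in v , v∈ , trans (cong r fv≡j) rj≡i }
  , refl , cong r

met? : ∀ {n k} (g : Fin n → Fin k) (S : Subset n) i → Dec (∃[ v ] v ∈ S × g v ≡ i)
met? g S i = Fin.any? (inFibre? g S i)

image : ∀ {n k} → (Fin n → Fin k) → Subset n → Subset k
image g S = subset (met? g S)

∈-image⁺ : ∀ {n k} (g : Fin n → Fin k) {S v} → v ∈ S → g v ∈ image g S
∈-image⁺ g {S} {v} v∈ = ∈-subset⁺ (met? g S) (v , v∈ , refl)

-- x, y: edges cut before and after merging; K and K - r: one less than the number of classes.
merge-arith : ∀ x y c {r t} K → y + c ≤ x → x * (K ∸ r) ≤ y * K → r ≤ t → c * K ≤ x * t
merge-arith x y c {r} {t} K y+c≤x opt r≤t = ℕ.+-cancelˡ-≤ (y * K) _ _ (begin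
  y * K + c * K          ≡⟨ ℕ.*-distribʳ-+ K y c ⟨
  (y + c) * K            ≤⟨ ℕ.*-monoˡ-≤ K y+c≤x ⟩
  -- Separates the `r` classes lost from the rest, to which `opt` applies.
  x * K                  ≤⟨ ℕ.*-monoʳ-≤ x (ℕ.m≤n+m∸n K r) ⟩
  x * (r + (K ∸ r))      ≡⟨ ℕ.*-distribˡ-+ x r (K ∸ r) ⟩
  x * r + x * (K ∸ r)    ≤⟨ ℕ.+-mono-≤ (ℕ.*-monoʳ-≤ x r≤t) opt ⟩
  x * t + y * K          ≡⟨ ℕ.+-comm (x * t) (y * K) ⟩
  y * K + x * t          ∎)
  where open ℕ.≤-Reasoning

-- Comparing an optimal partition with finer and coarser ones.

module _ {n m : ℕ} (G : Multigraph n m) where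
  open Multigraph G

  edge⇒2≤∣S∣ : ∀ {S e} → e ∈ edges G S → 2 ≤ ∣ S ∣
  edge⇒2≤∣S∣ {S} {e} e∈ with u∈ , v∈ ← ∈-subset⁻ (inside? G S) e∈ = 2≤∣S∣ u∈ v∈ (loopless e)

  cut⊆edges : ∀ {S} (P : Partition S) → cut G P ⊆ edges G S
  cut⊆edges {S} P = ∈-subset⁺ (inside? G S) ∘ proj₁ ∘ ∈-subset⁻ (crossing? G S (Partition.label P))

  -- Compare with the partition into singletons.
  optimal⇒partVal≤density : ∀ {S} (P : Partition S) → Optimal G P → (2≤ : 2 ≤ ∣ S ∣) →
    partVal G P ℚ.≤ density G S 2≤
  optimal⇒partVal≤density {S} P opt 2≤ =
    -- The vertices are their own labels, and those in `S` are the ones in use.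
    let Q , size≡ , _ = relabel S 2≤ id (λ {j} j∈ → j , j∈ , refl) in
    ℚ.≤-trans (opt Q) (/pred-≤⁺ ∣ cut G Q ∣ ∣ edges G S ∣ (Partition.2≤size Q) 2≤
      (ℕ.*-mono-≤ (p⊆q⇒∣p∣≤∣q∣ (cut⊆edges Q)) (ℕ.≤-reflexive (cong (_∸ 1) (sym size≡)))))

  -- The classes met by S are merged into the class i₀; the labels then still in use form J.
  module Merge {T : Subset n} (P : Partition T) (opt : Optimal G P)
               {S : Subset n} (S⊆T : S ⊆ T) {u : Fin n} (u∈S : u ∈ S) where
    open Partition P

    I : Subset size
    I = image label S

    i₀ : Fin size
    i₀ = label u

    I⁻ J : Subset size
    I⁻ = I - i₀
    J  = ∁ I⁻

    ∣I⁻∣<∣I∣ : ∣ I⁻ ∣ < ∣ I ∣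
    ∣I⁻∣<∣I∣ = x∈p⇒∣p-x∣<∣p∣ (∈-image⁺ label u∈S)

    ∣I⁻∣≤∣I∣∸1 : ∣ I⁻ ∣ ≤ ∣ I ∣ ∸ 1
    ∣I⁻∣≤∣I∣∸1 = ℕ.∸-monoˡ-≤ 1 ∣I⁻∣<∣I∣

    -- This is `K - r` of `merge-arith`, with `K = size ∸ 1` and `r = ∣ I⁻ ∣`.
    ∣J∣∸1 : ∣ J ∣ ∸ 1 ≡ size ∸ 1 ∸ ∣ I⁻ ∣
    ∣J∣∸1 = trans (cong (_∸ 1) (∣∁p∣≡n∸∣p∣ I⁻)) (trans (ℕ.∸-+-assoc size ∣ I⁻ ∣ 1)
      (trans (cong (size ∸_) (ℕ.+-comm ∣ I⁻ ∣ 1)) (sym (ℕ.∸-+-assoc size 1 ∣ I⁻ ∣))))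

    collapse : ∀ i → Dec (i ∈ I) → Fin size
    collapse i (yes _) = i₀
    collapse i (no _)  = i

    merged : Fin n → Fin size
    merged v = collapse (label v) (label v ∈? I)

    collapse-merges : ∀ {i} (d : Dec (i ∈ I)) → i ∈ I → collapse i d ≡ i₀
    collapse-merges (yes _) _  = refl
    collapse-merges (no i∉) i∈ = contradiction i∈ i∉

    collapse-fixes : ∀ {i} (d : Dec (i ∈ I)) → (i ∈ I → i ≡ i₀) → collapse i d ≡ i
    collapse-fixes (yes i∈) eq = sym (eq i∈)
    collapse-fixes (no _)   _  = refl

    -- A label in `J` is either outside `I` or equal to `i₀`; merging fixes it in both cases, so a
    -- vertex that had it before still has it.
    hit : ∀ {j} → j ∈ J → ∃[ v ] v ∈ T × merged v ≡ j
    hit {j} j∈J =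
      let v , v∈ , eq = nonempty j in
      v , v∈ , trans (collapse-fixes (label v ∈? I) (only-i₀ (subst (_∈ J) (sym eq) j∈J))) eq
      where
      only-i₀ : ∀ {i} → i ∈ J → i ∈ I → i ≡ i₀
      only-i₀ {i} i∈J i∈I = decidable-stable (i Fin.≟ i₀) λ neq →
        x∈∁p⇒x∉p i∈J (x∈p∧x≢y⇒x∈p-y i∈I neq)

    crossing⊆cut : crossing G S label ⊆ cut G P
    crossing⊆cut e∈ with (u∈ , v∈) , neq ← ∈-subset⁻ (crossing? G S label) e∈ =
      ∈-subset⁺ (crossing? G T label) ((S⊆T u∈ , S⊆T v∈) , neq)

    -- Merging loses `∣ I⁻ ∣` classes and every crossing edge of `S`. Since the value must not drop,
    -- these edges are at most a proportional share of the cut.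
    crossing-bound : ∣ crossing G S label ∣ * (size ∸ 1) ≤ ∣ cut G P ∣ * (∣ I ∣ ∸ 1)
    crossing-bound with 2 ≤? ∣ J ∣
    -- Merging leaves fewer than two classes, so there is no partition to compare with; but then
    -- `K - r = 0`, and with `y = 0` the optimality inequality reads `0 ≤ 0`.
    ... | no 2≰ = merge-arith (∣ cut G P ∣) 0 (∣ crossing G S label ∣) (size ∸ 1)
      (p⊆q⇒∣p∣≤∣q∣ crossing⊆cut)
      (ℕ.≤-reflexive (trans (cong (∣ cut G P ∣ *_) (trans (sym ∣J∣∸1) (ℕ.m≤n⇒m∸n≡0 (ℕ.≤-pred (ℕ.≰⇒> 2≰)))))
                            (ℕ.*-zeroʳ ∣ cut G P ∣)))
      ∣I⁻∣≤∣I∣∸1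
    ... | yes 2≤ with Q , size≡ , label-cong ← relabel J 2≤ merged hit =
      merge-arith (∣ cut G P ∣) (∣ cut G Q ∣) (∣ crossing G S label ∣) (size ∸ 1)
        (disjoint⇒∣S∣+∣T∣≤∣U∣ Q⊆P crossing⊆cut disjoint)
        (subst (λ q → ∣ cut G P ∣ * q ≤ ∣ cut G Q ∣ * (size ∸ 1)) (trans (cong (_∸ 1) size≡) ∣J∣∸1)
          (/pred-≤⁻ ∣ cut G P ∣ ∣ cut G Q ∣ 2≤size (Partition.2≤size Q) (opt Q)))
        ∣I⁻∣≤∣I∣∸1
      where
      labelQ = Partition.label Q

      Q⊆P : cut G Q ⊆ cut G P
      Q⊆P e∈ with uv∈ , neq ← ∈-subset⁻ (crossing? G T labelQ) e∈ =
        ∈-subset⁺ (crossing? G T label)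
          (uv∈ , λ eq → neq (label-cong (cong (λ i → collapse i (i ∈? I)) eq)))

      -- An edge inside `S` has both ends in the merged class `i₀`.
      disjoint : ∀ {e} → e ∈ cut G Q → e ∉ crossing G S label
      disjoint {e} e∈Q e∈S with (u∈ , v∈) , _ ← ∈-subset⁻ (crossing? G S label) e∈S =
        proj₂ (∈-subset⁻ (crossing? G T labelQ) e∈Q) (label-cong
          (trans (collapse-merges (label (src e) ∈? I) (∈-image⁺ label u∈))
            (sym (collapse-merges (label (tgt e) ∈? I) (∈-image⁺ label v∈)))))

  -- A densest set split by a labelling.

  -- The hypothesis `densest` is maximality of the density `E / d` of `S`, with denominators
  -- cleared.
  module Densest {S : Subset n} (2≤S : 2 ≤ ∣ S ∣)
    (densest : ∀ T → 2 ≤ ∣ T ∣ → ∣ edges G T ∣ * (∣ S ∣ ∸ 1) ≤ ∣ edges G S ∣ * (∣ T ∣ ∸ 1)) where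

    E d : ℕ
    E = ∣ edges G S ∣
    d = ∣ S ∣ ∸ 1

    suc-d : suc d ≡ ∣ S ∣
    suc-d = ℕ.m+[n∸m]≡n (ℕ.≤-trans (s≤s z≤n) 2≤S)

    module _ {k : ℕ} (label : Fin n → Fin k) where

      I : Subset k
      I = image label S

      S′ : Fin k → Subset n
      S′ = fibre label S

      -- Maximal density applied to a fibre. The indicator stands for the 1 subtracted from the size
      -- of each nonempty fibre; it is moved to the left to avoid truncated subtraction.
      fibre-bound : ∀ i → ∣ edges G (S′ i) ∣ * d + E * 𝟙 (i ∈? I) ≤ E * ∣ S′ i ∣
      fibre-bound i with 2 ≤? ∣ S′ i ∣
      ... | yes 2≤ = begin
        ∣ edges G (S′ i) ∣ * d + E * 𝟙 (i ∈? I)  ≤⟨ ℕ.+-mono-≤ (densest (S′ i) 2≤) (ℕ.*-monoʳ-≤ E (𝟙≤1 (i ∈? I))) ⟩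
        E * (∣ S′ i ∣ ∸ 1) + E * 1               ≡⟨ ℕ.*-distribˡ-+ E (∣ S′ i ∣ ∸ 1) 1 ⟨
        E * (∣ S′ i ∣ ∸ 1 + 1)                   ≡⟨ cong (E *_) (ℕ.m∸n+n≡m (ℕ.≤-trans (s≤s z≤n) 2≤)) ⟩
        E * ∣ S′ i ∣                             ∎
        where open ℕ.≤-Reasoning
      -- A fibre with at most one vertex spans no edge, as there are no loops.
      ... | no 2≰ = ℕ.+-mono-≤ (ℕ.*-monoˡ-≤ d no-edges) (ℕ.*-monoʳ-≤ E (met-nonempty (i ∈? I)))
        where
        no-edges : ∣ edges G (S′ i) ∣ ≤ 0
        no-edges = ℕ.≮⇒≥ λ 0< → 2≰ (edge⇒2≤∣S∣ {S′ i} (proj₂ (member _ 0<)))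

        met-nonempty : (i∈? : Dec (i ∈ I)) → 𝟙 i∈? ≤ ∣ S′ i ∣
        met-nonempty (no _) = z≤n
        met-nonempty (yes i∈) with v , v∈ , refl ← ∈-subset⁻ (met? label S) i∈ = 1≤∣S∣ (∈-fibre⁺ label v∈)

      inner? : ∀ e → Dec ((src e ∈ S × tgt e ∈ S) × label (src e) ≡ label (tgt e))
      inner? e = inside? G S e ×-dec (label (src e) Fin.≟ label (tgt e))

      inner : Subset m
      inner = subset inner?

      E≤crossing+inner : E ≤ ∣ crossing G S label ∣ + ∣ inner ∣
      E≤crossing+inner = cover⇒∣U∣≤∣S∣+∣T∣ λ {e} e∈ →
        classify (∈-subset⁻ (inside? G S) e∈) (label (src e) Fin.≟ label (tgt e))
        where
        classify : ∀ {e} → src e ∈ S × tgt e ∈ S → Dec (label (src e) ≡ label (tgt e)) →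
          e ∈ crossing G S label ⊎ e ∈ inner
        classify uv∈ (yes eq) = inj₂ (∈-subset⁺ inner? (uv∈ , eq))
        classify uv∈ (no neq) = inj₁ (∈-subset⁺ (crossing? G S label) (uv∈ , neq))

      -- Inner edges are sorted by the label of their source, which is also that of their target.
      inner≤∑ : ∣ inner ∣ ≤ ∑[ i < k ] ∣ edges G (S′ i) ∣
      inner≤∑ = subst (_≤ ∑[ i < k ] ∣ edges G (S′ i) ∣) (∑∣fibre∣≡∣S∣ (label ∘ src) inner)
        (sum-mono λ i → p⊆q⇒∣p∣≤∣q∣ (inner-fibre i))
        where
        inner-fibre : ∀ i → fibre (label ∘ src) inner i ⊆ edges G (S′ i)
        inner-fibre i e∈
          with e∈inner , src∈i ← ∈-fibre⁻ (label ∘ src) e∈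
          with (u∈ , v∈) , eq ← ∈-subset⁻ inner? e∈inner =
          ∈-subset⁺ (inside? G (S′ i))
            ( ∈-subset⁺ (inFibre? label S i) (u∈ , src∈i)
            , ∈-subset⁺ (inFibre? label S i) (v∈ , trans (sym eq) src∈i))

      ∑-bound : (∑[ i < k ] ∣ edges G (S′ i) ∣) * d + E * ∣ I ∣ ≤ E * ∣ S ∣
      ∑-bound = begin
        (∑[ i < k ] ∣ edges G (S′ i) ∣) * d + E * ∣ I ∣
          ≡⟨ cong₂ _+_ (*-distribʳ-sum d λ i → ∣ edges G (S′ i) ∣) (trans (cong (E *_) (∣S∣≡∑ I)) (*-distribˡ-sum E λ i → 𝟙 (i ∈? I))) ⟩
        ∑[ i < k ] (∣ edges G (S′ i) ∣ * d) + ∑[ i < k ] (E * 𝟙 (i ∈? I))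
          ≡⟨ ∑-distrib-+ (λ i → ∣ edges G (S′ i) ∣ * d) _ ⟨
        ∑[ i < k ] (∣ edges G (S′ i) ∣ * d + E * 𝟙 (i ∈? I))
          ≤⟨ sum-mono fibre-bound ⟩
        ∑[ i < k ] (E * ∣ S′ i ∣)
          ≡⟨ *-distribˡ-sum E (λ i → ∣ S′ i ∣) ⟨
        E * (∑[ i < k ] ∣ S′ i ∣)
          ≡⟨ cong (E *_) (∑∣fibre∣≡∣S∣ label S) ⟩
        E * ∣ S ∣ ∎
        where open ℕ.≤-Reasoning

      -- The fibres span at most `(E / d)(∣ S ∣ - ∣ I ∣)` of the `E = (E / d)(∣ S ∣ - 1)` edges, so
      -- at least `(E / d)(∣ I ∣ - 1)` cross.
      crossing-lower-bound : E * (∣ I ∣ ∸ 1) ≤ ∣ crossing G S label ∣ * d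
      crossing-lower-bound = begin
        E * (∣ I ∣ ∸ 1)      ≡⟨ ℕ.*-distribˡ-∸ E ∣ I ∣ 1 ⟩
        E * ∣ I ∣ ∸ E * 1    ≤⟨ ℕ.m≤n+o⇒m∸n≤o (E * ∣ I ∣) (E * 1) (ℕ.+-cancelˡ-≤ (E * d) _ _ total) ⟩
        c * d                ∎
        where
        open ℕ.≤-Reasoning
        c s : ℕ
        c = ∣ crossing G S label ∣
        s = ∑[ i < k ] ∣ edges G (S′ i) ∣

        rearrange : ∀ c d E → c * d + E * suc d ≡ E * d + (E * 1 + c * d)
        rearrange = solve-∀

        total : E * d + E * ∣ I ∣ ≤ E * d + (E * 1 + c * d)
        total = begin
          E * d + E * ∣ I ∣              ≤⟨ ℕ.+-monoˡ-≤ _ (ℕ.*-monoˡ-≤ d (ℕ.≤-trans E≤crossing+inner (ℕ.+-monoʳ-≤ c inner≤∑))) ⟩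
          (c + s) * d + E * ∣ I ∣        ≡⟨ cong (_+ E * ∣ I ∣) (ℕ.*-distribʳ-+ d c s) ⟩
          c * d + s * d + E * ∣ I ∣      ≡⟨ ℕ.+-assoc (c * d) _ _ ⟩
          c * d + (s * d + E * ∣ I ∣)    ≤⟨ ℕ.+-monoʳ-≤ (c * d) ∑-bound ⟩
          c * d + E * ∣ S ∣              ≡⟨ cong (λ z → c * d + E * z) suc-d ⟨
          c * d + E * suc d              ≡⟨ rearrange c d E ⟩
          E * d + (E * 1 + c * d)        ∎

    -- Eliminates `c` between `E t ≤ c d` and `c K ≤ x t`, then cancels `t`, which is positive
    -- because `u` and `v` lie in different classes.
    split⇒density≤partVal : ∀ {T} (P : Partition T) → Optimal G P → S ⊆ T →
      ∀ {u v} → u ∈ S → v ∈ S → Partition.label P u ≢ Partition.label P v →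
      E * (Partition.size P ∸ 1) ≤ ∣ cut G P ∣ * d
    split⇒density≤partVal P opt S⊆T u∈ v∈ u≢v =
      ℕ.*-cancelʳ-≤ _ _ t {{>-nonZero (ℕ.m<n⇒0<n∸m 2≤I)}} (begin
        E * K * t     ≡⟨ swap E K t ⟩
        E * t * K     ≤⟨ ℕ.*-monoˡ-≤ K (crossing-lower-bound label) ⟩
        c * d * K     ≡⟨ swap c d K ⟩
        c * K * d     ≤⟨ ℕ.*-monoˡ-≤ d crossing-bound ⟩
        x * t * d     ≡⟨ swap x t d ⟩
        x * d * t     ∎)
      where
      open ℕ.≤-Reasoning
      open Partition P
      open Merge P opt S⊆T u∈ using (crossing-bound)
      c x t K : ℕ
      c = ∣ crossing G S label ∣
      x = ∣ cut G P ∣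
      t = ∣ image label S ∣ ∸ 1
      K = size ∸ 1

      2≤I : 2 ≤ ∣ image label S ∣
      2≤I = 2≤∣S∣ (∈-image⁺ label u∈) (∈-image⁺ label v∈) u≢v

      swap : ∀ a b c → a * b * c ≡ a * c * b
      swap = solve-∀

  -- Descending the recursion that defines the loads.

  -- Bundling positivity lets partition values be compared with densities directly, leaving
  -- reciprocals to the end.
  HasInverseLoad : (Fin m → ℚ) → Fin m → ℚ → Set
  HasInverseLoad ℓ e q = Σ (ℚ.Positive q) λ q>0 → ℓ e ≡ (1/ q) {{ℚ.pos⇒nonZero q {{q>0}}}}

  cut-inverseLoad : ∀ {ℓ T} (P : Partition T) →
    (∀ {e} (e∈ : e ∈ cut G P) → ℓ e ≡ 1/_ (partVal G P) {{partVal≢0 G P e∈}}) →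
    ∀ {e} → e ∈ cut G P → HasInverseLoad ℓ e (partVal G P)
  cut-inverseLoad P loads e∈ = /pred-positive ∣ cut G P ∣ (Partition.2≤size P) (1≤∣S∣ e∈) , loads e∈

  -- Recursion into the class containing both ends of `e`, until a partition cuts `e`; the set it
  -- partitions is the witness.
  inverseLoad≤density : ∀ {ℓ T} → IsIdealOn G ℓ T → ∀ {e} → e ∈ edges G T →
    ∃[ q ] HasInverseLoad ℓ e q × ∃[ S ] Σ (2 ≤ ∣ S ∣) λ 2≤ → q ℚ.≤ density G S 2≤
  inverseLoad≤density {ℓ} {T} (split P opt loads rec) {e} e∈ =
    step (∈-subset⁻ (inside? G T) e∈) (label (src e) Fin.≟ label (tgt e))
    where
    open Partition P
    step : src e ∈ T × tgt e ∈ T → Dec (label (src e) ≡ label (tgt e)) →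
      ∃[ q ] HasInverseLoad ℓ e q × ∃[ S ] Σ (2 ≤ ∣ S ∣) λ 2≤ → q ℚ.≤ density G S 2≤
    step uv∈ (no neq) =
      partVal G P , cut-inverseLoad P loads (∈-subset⁺ (crossing? G T label) (uv∈ , neq)) ,
      T , edge⇒2≤∣S∣ {T} e∈ , optimal⇒partVal≤density P opt (edge⇒2≤∣S∣ {T} e∈)
    step (u∈ , v∈) (yes eq) = inverseLoad≤density (rec i (edge⇒2≤∣S∣ {Class i} e∈i)) e∈i
      where
      i = label (src e)
      e∈i : e ∈ edges G (Class i)
      e∈i = ∈-subset⁺ (inside? G (Class i))
        (∈-subset⁺ (inClass? i) (u∈ , refl) , ∈-subset⁺ (inClass? i) (v∈ , sym eq))

  -- Recursion into the class containing `S`, until a partition separates `S`; any edge it cuts is a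
  -- witness.
  density≤inverseLoad : ∀ {ℓ S} (2≤S : 2 ≤ ∣ S ∣) →
    (∀ T (2≤T : 2 ≤ ∣ T ∣) → density G T 2≤T ℚ.≤ density G S 2≤S) → 0 < ∣ edges G S ∣ →
    ∀ {T} → IsIdealOn G ℓ T → S ⊆ T →
    ∃[ e ] ∃[ q ] HasInverseLoad ℓ e q × density G S 2≤S ℚ.≤ q
  density≤inverseLoad {ℓ} {S} 2≤S densest 0<E (split P opt loads rec) S⊆T =
    step (Fin.any? λ v → (v ∈? S) ×-dec ¬? (label v Fin.≟ label u))
    where
    open Partition P
    open Densest 2≤S (λ T 2≤T → /pred-≤⁻ ∣ edges G T ∣ ∣ edges G S ∣ 2≤T 2≤S (densest T 2≤T))

    member-S : ∃[ u ] u ∈ S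
    member-S = member S (ℕ.≤-trans (s≤s z≤n) 2≤S)

    u = proj₁ member-S

    step : Dec (∃[ v ] v ∈ S × label v ≢ label u) →
      ∃[ e ] ∃[ q ] HasInverseLoad ℓ e q × density G S 2≤S ℚ.≤ q
    step (yes (v , v∈ , v≢u)) =
      proj₁ cut-edge , partVal G P , cut-inverseLoad P loads (proj₂ cut-edge) ,
      /pred-≤⁺ E ∣ cut G P ∣ 2≤S 2≤size bound
      where
      bound : E * (size ∸ 1) ≤ ∣ cut G P ∣ * d
      bound = split⇒density≤partVal P opt S⊆T v∈ (proj₂ member-S) v≢u

      -- With an empty cut, `bound` would make the positive number `E * (size ∸ 1)` at most 0.
      cut-nonempty : 0 < ∣ cut G P ∣
      cut-nonempty = ℕ.n≢0⇒n>0 λ cut≡0 → ℕ.<⇒≱ (ℕ.*-mono-< 0<E (ℕ.m<n⇒0<n∸m 2≤size))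
        (subst (λ x → E * (size ∸ 1) ≤ x * d) cut≡0 bound)

      cut-edge : ∃[ e ] e ∈ cut G P
      cut-edge = member (cut G P) cut-nonempty
    step (no unsplit) = density≤inverseLoad 2≤S densest 0<E
      (rec (label u) (ℕ.≤-trans 2≤S (p⊆q⇒∣p∣≤∣q∣ S⊆Class))) S⊆Class
      where
      S⊆Class : S ⊆ Class (label u)
      S⊆Class {v} v∈ = ∈-subset⁺ (inClass? (label u))
        (S⊆T v∈ , decidable-stable (label v Fin.≟ label u) λ v≢u → unsplit (v , v∈ , v≢u))

-- Combining both bounds at an edge of least load.

theorem1 : ∀ {n m : ℕ} (G : Multigraph n m) → 2 ≤ n → Connected G →
    ∀ {α : ℚ} → IsFractionalArboricity G α →
    ∀ {ℓ : Fin m → ℚ} → IsIdealLoads G ℓ →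
    ∀ {ℓmin : ℚ} → IsMinLoad G ℓ ℓmin →
    Σ (NonZero ℓmin) λ ℓmin≢0 → α ≡ 1/_ ℓmin {{ℓmin≢0}}
theorem1 {n} G 2≤n _ ((S , 2≤S , refl) , greatest) {ℓ} ideal ((e₀ , refl) , least) =
  conclude (inverseLoad≤density G ideal e₀∈⊤)
           (density≤inverseLoad G 2≤S (λ U 2≤U → greatest (U , 2≤U , refl)) 0<E ideal (λ _ → ∈⊤))
  where
  e₀∈⊤ : e₀ ∈ edges G ⊤
  e₀∈⊤ = ∈-subset⁺ (inside? G ⊤) (∈⊤ , ∈⊤)

  ⊤-dense : ∣ edges G ⊤ ∣ * (∣ S ∣ ∸ 1) ≤ ∣ edges G S ∣ * (∣ ⊤ {n} ∣ ∸ 1)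
  ⊤-dense = /pred-≤⁻ ∣ edges G ⊤ ∣ ∣ edges G S ∣ (2≤∣⊤∣ 2≤n) 2≤S (greatest (⊤ , 2≤∣⊤∣ 2≤n , refl))

  -- The edge `e₀` gives the whole vertex set positive density, and `S` is at least as dense.
  0<E : 0 < ∣ edges G S ∣
  0<E = ℕ.n≢0⇒n>0 λ E≡0 →
    ℕ.<⇒≱ (ℕ.*-mono-< (1≤∣S∣ e₀∈⊤) (ℕ.m<n⇒0<n∸m 2≤S))
      (subst (λ x → ∣ edges G ⊤ ∣ * (∣ S ∣ ∸ 1) ≤ x * (∣ ⊤ {n} ∣ ∸ 1)) E≡0 ⊤-dense)

  1/-swap : ∀ {p q} {{q>0 : ℚ.Positive q}} → p ≡ (1/ q) {{ℚ.pos⇒nonZero q}} →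
    Σ (NonZero p) λ p≢0 → q ≡ (1/ p) {{p≢0}}
  1/-swap {q = q} refl = ℚ.nonZero⇒1/nonZero q , sym (ℚ.1/-involutive q)
    where instance _ = ℚ.pos⇒nonZero q

  conclude :
    ∃[ q ] HasInverseLoad G ℓ e₀ q × (∃[ T ] Σ (2 ≤ ∣ T ∣) λ 2≤T → q ℚ.≤ density G T 2≤T) →
    ∃[ e ] ∃[ q ] HasInverseLoad G ℓ e q × density G S 2≤S ℚ.≤ q →
    Σ (NonZero (ℓ e₀)) λ ℓmin≢0 → density G S 2≤S ≡ (1/ ℓ e₀) {{ℓmin≢0}}
  conclude (q₀ , (q₀>0 , ℓe₀≡) , T , 2≤T , q₀≤) (e₁ , q₁ , (q₁>0 , ℓe₁≡) , α≤q₁) =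
    subst (λ x → Σ (NonZero (ℓ e₀)) λ ≢0 → x ≡ (1/ ℓ e₀) {{≢0}}) (sym α≡q₀)
      (1/-swap {{q₀>0}} ℓe₀≡)
    where
    -- The load `1/ q₀` of `e₀` is least, so `q₀` is the largest inverse load; this closes the cycle
    -- `α ≤ q₁ ≤ q₀ ≤ α`.
    q₁≤q₀ : q₁ ℚ.≤ q₀
    q₁≤q₀ = 1/-cancel-≤-pos q₀ q₁ {{q₀>0}} {{q₁>0}} (subst₂ ℚ._≤_ ℓe₀≡ ℓe₁≡ (least (e₁ , refl)))

    α≡q₀ : density G S 2≤S ≡ q₀
    α≡q₀ = ℚ.≤-antisym (ℚ.≤-trans α≤q₁ q₁≤q₀) (ℚ.≤-trans q₀≤ (greatest (T , 2≤T , refl)))
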